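{- There exists an absolute constant $c>0$ such that for every integer $M\ge 1$, every $M$-solution ordinal algorithm for makespan minimization on $m=2$ identical machines has competitive ratio at least $1+\frac{c}{M^2}$. In particular, for every fixed number $M$ of parallel solutions, the competitive ratio is strictly larger than $1$ (that is, it is $1+\Omega(\frac{1}{M^2})$).
   Context: Ordinal makespan scheduling on $m$ identical machines. Jobs are indexed by positive integers. A realization is a sequence of real job sizes $p_1\ge p_2\ge p_3\ge\cdots\ge 0$ with only finitely many positive sizes. A solution is a partition of the set of all positive integers into $m$ sets $J_1,\dots,J_m$ (some may be empty), where $J_i$ is the set of jobs assigned to machine $i$; it is fixed without knowledge of the realization. For a realization, the load of machine $i$ in the solution is $\sum_{j\in J_i}p_j$, and the completion time of the solution is the maximum load of any machine. An $M$-solution ordinal algorithm consists of $M$ solutions; its makespan for a realization is the minimum of the completion times of its $M$ solutions for that realization. The optimal offline completion time $\lambda$ of a realization is the minimum completion time over all solutions (chosen with full knowledge of the realization). The competitive ratio of the algorithm is the supremum, over all realizations with $\lambda>0$, of the ratio between its makespan and $\lambda$. -}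

module Defs where

open import Data.Nat as ℕ using (ℕ; zero; suc; NonZero)
import Data.Nat.Properties as ℕ
open import Data.Integer using (+_)
open import Data.Rational as ℚ using (ℚ; 0ℚ; 1ℚ; ½; ∣_∣)
import Data.Rational.Properties as ℚ
open import Data.Rational.Solver using (module +-*-Solver)
open import Data.Fin using (Fin; zero; suc)
import Data.Fin.Properties as Fin
open import Data.Bool using (if_then_else_)
open import Data.Product using (∃; ∃-syntax; _×_; _,_)
open import Data.Sum using (inj₁; inj₂)
open import Function using (_∘_)
open import Relation.Nullary using (¬_; does)
open import Relation.Binary.PropositionalEquality using (_≡_; refl; sym; cong; cong₂; subst)

------------------------------------------------------------------------
-- Real numbers as Cauchy sequences of rationals, compared by _≃_

IsCauchy : (ℕ → ℚ) → Set
IsCauchy x = ∀ ε → 0ℚ ℚ.< ε →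
  ∃[ N ] (∀ m n → N ℕ.≤ m → N ℕ.≤ n → ∣ x m ℚ.- x n ∣ ℚ.< ε)

record ℝ : Set where
  constructor mkℝ
  field
    seq    : ℕ → ℚ
    cauchy : IsCauchy seq

open ℝ public

infix 4 _<_ _≤_ _≃_

_<_ : ℝ → ℝ → Set
x < y = ∃[ ε ] 0ℚ ℚ.< ε × ∃[ N ] (∀ n → N ℕ.≤ n → seq x n ℚ.+ ε ℚ.≤ seq y n)

_≤_ : ℝ → ℝ → Set
x ≤ y = ¬ (y < x)

_≃_ : ℝ → ℝ → Set
x ≃ y = x ≤ y × y ≤ x

private
  p≤∣p∣ : ∀ p → p ℚ.≤ ∣ p ∣
  p≤∣p∣ p with ℚ.∣p∣≡p∨∣p∣≡-p p | ℚ.≤-total 0ℚ p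
  ... | inj₁ e | _       = ℚ.≤-reflexive (sym e)
  ... | inj₂ _ | inj₁ 0≤p = ℚ.≤-reflexive (sym (ℚ.0≤p⇒∣p∣≡p 0≤p))
  ... | inj₂ _ | inj₂ p≤0 = ℚ.≤-trans p≤0 (ℚ.0≤∣p∣ p)

  ∣∣-comm : ∀ p q → ∣ p ℚ.- q ∣ ≡ ∣ q ℚ.- p ∣
  ∣∣-comm p q = begin
    ∣ p ℚ.- q ∣         ≡⟨ cong ∣_∣ (solve 2 (λ p q → p :- q := :- (q :- p)) refl p q) ⟩
    ∣ ℚ.- (q ℚ.- p) ∣   ≡⟨ ℚ.∣-p∣≡∣p∣ (q ℚ.- p) ⟩
    ∣ q ℚ.- p ∣         ∎
    where open +-*-Solver
          open Relation.Binary.PropositionalEquality.≡-Reasoning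

  ≤-shift : ∀ p q → p ℚ.≤ q ℚ.+ ∣ p ℚ.- q ∣
  ≤-shift p q = begin
    p                      ≡⟨ solve 2 (λ p q → p := q :+ (p :- q)) refl p q ⟩
    q ℚ.+ (p ℚ.- q)        ≤⟨ ℚ.+-monoʳ-≤ q (p≤∣p∣ (p ℚ.- q)) ⟩
    q ℚ.+ ∣ p ℚ.- q ∣      ∎
    where open +-*-Solver
          open ℚ.≤-Reasoning

  p≤p+q : ∀ p {q} → 0ℚ ℚ.≤ q → p ℚ.≤ p ℚ.+ q
  p≤p+q p {q} 0≤q = subst (ℚ._≤ p ℚ.+ q) (ℚ.+-identityʳ p) (ℚ.+-monoʳ-≤ p 0≤q)

  p≤q+p : ∀ {p} q → 0ℚ ℚ.≤ q → p ℚ.≤ q ℚ.+ p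
  p≤q+p {p} q 0≤q = subst (ℚ._≤ q ℚ.+ p) (ℚ.+-identityˡ p) (ℚ.+-monoˡ-≤ p 0≤q)

  ∣∣-bound : ∀ p q d → p ℚ.≤ q ℚ.+ d → q ℚ.≤ p ℚ.+ d → ∣ p ℚ.- q ∣ ℚ.≤ d
  ∣∣-bound p q d p≤ q≤ with ℚ.∣p∣≡p∨∣p∣≡-p (p ℚ.- q)
  ... | inj₁ e = begin
    ∣ p ℚ.- q ∣          ≡⟨ e ⟩
    p ℚ.- q              ≤⟨ ℚ.+-monoˡ-≤ (ℚ.- q) p≤ ⟩
    q ℚ.+ d ℚ.- q        ≡⟨ solve 2 (λ q d → q :+ d :- q := d) refl q d ⟩
    d                    ∎
    where open +-*-Solver
          open ℚ.≤-Reasoning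
  ... | inj₂ e = begin
    ∣ p ℚ.- q ∣          ≡⟨ e ⟩
    ℚ.- (p ℚ.- q)        ≡⟨ solve 2 (λ p q → :- (p :- q) := q :- p) refl p q ⟩
    q ℚ.- p              ≤⟨ ℚ.+-monoˡ-≤ (ℚ.- p) q≤ ⟩
    p ℚ.+ d ℚ.- p        ≡⟨ solve 2 (λ p d → p :+ d :- p := d) refl p d ⟩
    d                    ∎
    where open +-*-Solver
          open ℚ.≤-Reasoning

  _⊕_ : ℚ → ℚ → ℚ
  a ⊕ b = 1ℚ ℚ.* a ℚ.+ 1ℚ ℚ.* b

  ⊕≡+ : ∀ a b → a ⊕ b ≡ a ℚ.+ b
  ⊕≡+ a b = cong₂ ℚ._+_ (ℚ.*-identityˡ a) (ℚ.*-identityˡ b)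

  +-lip : ∀ a a′ b b′ →
          ∣ (a ℚ.+ b) ℚ.- (a′ ℚ.+ b′) ∣ ℚ.≤ ∣ a ℚ.- a′ ∣ ⊕ ∣ b ℚ.- b′ ∣
  +-lip a a′ b b′ = begin
    ∣ (a ℚ.+ b) ℚ.- (a′ ℚ.+ b′) ∣   ≡⟨ cong ∣_∣ (solve 4 (λ a a′ b b′ → (a :+ b) :- (a′ :+ b′) := (a :- a′) :+ (b :- b′)) refl a a′ b b′) ⟩
    ∣ (a ℚ.- a′) ℚ.+ (b ℚ.- b′) ∣   ≤⟨ ℚ.∣p+q∣≤∣p∣+∣q∣ (a ℚ.- a′) (b ℚ.- b′) ⟩
    ∣ a ℚ.- a′ ∣ ℚ.+ ∣ b ℚ.- b′ ∣    ≡⟨ ⊕≡+ ∣ a ℚ.- a′ ∣ ∣ b ℚ.- b′ ∣ ⟨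
    ∣ a ℚ.- a′ ∣ ⊕ ∣ b ℚ.- b′ ∣      ∎
    where open +-*-Solver
          open ℚ.≤-Reasoning

  ⊔-lip₁ : ∀ a a′ b b′ →
           a ℚ.⊔ b ℚ.≤ (a′ ℚ.⊔ b′) ℚ.+ (∣ a ℚ.- a′ ∣ ℚ.+ ∣ b ℚ.- b′ ∣)
  ⊔-lip₁ a a′ b b′ = ℚ.⊔-lub
    (ℚ.≤-trans (≤-shift a a′) (ℚ.+-mono-≤ (ℚ.p≤p⊔q a′ b′) (p≤p+q _ (ℚ.0≤∣p∣ (b ℚ.- b′)))))
    (ℚ.≤-trans (≤-shift b b′) (ℚ.+-mono-≤ (ℚ.p≤q⊔p a′ b′) (p≤q+p _ (ℚ.0≤∣p∣ (a ℚ.- a′)))))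

  ⊓-lip₁ : ∀ a a′ b b′ →
           a ℚ.⊓ b ℚ.≤ (a′ ℚ.⊓ b′) ℚ.+ (∣ a ℚ.- a′ ∣ ℚ.+ ∣ b ℚ.- b′ ∣)
  ⊓-lip₁ a a′ b b′ with ℚ.⊓-sel a′ b′
  ... | inj₁ e rewrite e = ℚ.≤-trans (ℚ.p⊓q≤p a b)
    (ℚ.≤-trans (≤-shift a a′) (ℚ.+-monoʳ-≤ a′ (p≤p+q _ (ℚ.0≤∣p∣ (b ℚ.- b′)))))
  ... | inj₂ e rewrite e = ℚ.≤-trans (ℚ.p⊓q≤q a b)
    (ℚ.≤-trans (≤-shift b b′) (ℚ.+-monoʳ-≤ b′ (p≤q+p _ (ℚ.0≤∣p∣ (a ℚ.- a′)))))

  symm-lip : (f : ℚ → ℚ → ℚ) →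
    (∀ a a′ b b′ → f a b ℚ.≤ f a′ b′ ℚ.+ (∣ a ℚ.- a′ ∣ ℚ.+ ∣ b ℚ.- b′ ∣)) →
    ∀ a a′ b b′ → ∣ f a b ℚ.- f a′ b′ ∣ ℚ.≤ ∣ a ℚ.- a′ ∣ ⊕ ∣ b ℚ.- b′ ∣
  symm-lip f h a a′ b b′ = subst (∣ f a b ℚ.- f a′ b′ ∣ ℚ.≤_)
    (sym (⊕≡+ ∣ a ℚ.- a′ ∣ ∣ b ℚ.- b′ ∣))
    (∣∣-bound (f a b) (f a′ b′) _ (h a a′ b b′)
      (subst (λ d → f a′ b′ ℚ.≤ f a b ℚ.+ d)
        (cong₂ ℚ._+_ (∣∣-comm a′ a) (∣∣-comm b′ b)) (h a′ a b′ b)))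

  *-lip : ∀ a a′ b b′ A B → ∣ a ∣ ℚ.≤ A → ∣ b′ ∣ ℚ.≤ B →
          ∣ a ℚ.* b ℚ.- a′ ℚ.* b′ ∣ ℚ.≤ B ℚ.* ∣ a ℚ.- a′ ∣ ℚ.+ A ℚ.* ∣ b ℚ.- b′ ∣
  *-lip a a′ b b′ A B ≤A ≤B = begin
    ∣ a ℚ.* b ℚ.- a′ ℚ.* b′ ∣
      ≡⟨ cong ∣_∣ (solve 4 (λ a a′ b b′ → a :* b :- a′ :* b′ := b′ :* (a :- a′) :+ a :* (b :- b′)) refl a a′ b b′) ⟩
    ∣ b′ ℚ.* (a ℚ.- a′) ℚ.+ a ℚ.* (b ℚ.- b′) ∣
      ≤⟨ ℚ.∣p+q∣≤∣p∣+∣q∣ (b′ ℚ.* (a ℚ.- a′)) (a ℚ.* (b ℚ.- b′)) ⟩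
    ∣ b′ ℚ.* (a ℚ.- a′) ∣ ℚ.+ ∣ a ℚ.* (b ℚ.- b′) ∣
      ≡⟨ cong₂ ℚ._+_ (ℚ.∣p*q∣≡∣p∣*∣q∣ b′ (a ℚ.- a′)) (ℚ.∣p*q∣≡∣p∣*∣q∣ a (b ℚ.- b′)) ⟩
    ∣ b′ ∣ ℚ.* ∣ a ℚ.- a′ ∣ ℚ.+ ∣ a ∣ ℚ.* ∣ b ℚ.- b′ ∣
      ≤⟨ ℚ.+-mono-≤
           (ℚ.*-monoʳ-≤-nonNeg ∣ a ℚ.- a′ ∣ {{ℚ.∣-∣-nonNeg (a ℚ.- a′)}} ≤B)
           (ℚ.*-monoʳ-≤-nonNeg ∣ b ℚ.- b′ ∣ {{ℚ.∣-∣-nonNeg (b ℚ.- b′)}} ≤A) ⟩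
    B ℚ.* ∣ a ℚ.- a′ ∣ ℚ.+ A ℚ.* ∣ b ℚ.- b′ ∣ ∎
    where open +-*-Solver
          open ℚ.≤-Reasoning

  0<½* : ∀ ε → 0ℚ ℚ.< ε → 0ℚ ℚ.< ½ ℚ.* ε
  0<½* ε 0<ε = subst (ℚ._< ½ ℚ.* ε) (ℚ.*-zeroʳ ½) (ℚ.*-monoʳ-<-pos ½ 0<ε)

  scale : ∀ A → 0ℚ ℚ.< A → ∀ ε → 0ℚ ℚ.< ε →
          ∃[ δ ] 0ℚ ℚ.< δ × (∀ t → t ℚ.< δ → A ℚ.* t ℚ.< ε)
  scale A 0<A ε 0<ε = 1/A ℚ.* ε , 0<δ , bound
    where
    instance
      A-pos : ℚ.Positive A
      A-pos = ℚ.positive 0<A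
      A≢0 : ℚ.NonZero A
      A≢0 = ℚ.pos⇒nonZero A
    1/A : ℚ
    1/A = ℚ.1/ A
    0<δ : 0ℚ ℚ.< 1/A ℚ.* ε
    0<δ = subst (ℚ._< 1/A ℚ.* ε) (ℚ.*-zeroʳ 1/A)
      (ℚ.*-monoʳ-<-pos 1/A {{ℚ.1/pos⇒pos A}} 0<ε)
    open ℚ.≤-Reasoning
    bound : ∀ t → t ℚ.< 1/A ℚ.* ε → A ℚ.* t ℚ.< ε
    bound t t<δ = begin-strict
      A ℚ.* t               <⟨ ℚ.*-monoʳ-<-pos A t<δ ⟩
      A ℚ.* (1/A ℚ.* ε)     ≡⟨ ℚ.*-assoc A 1/A ε ⟨
      (A ℚ.* 1/A) ℚ.* ε     ≡⟨ cong (ℚ._* ε) (ℚ.*-inverseʳ A) ⟩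
      1ℚ ℚ.* ε              ≡⟨ ℚ.*-identityˡ ε ⟩
      ε                     ∎

  0<1 : 0ℚ ℚ.< 1ℚ
  0<1 = ℚ.positive⁻¹ 1ℚ

  abstract
    bounded : (x : ℝ) →
      ∃[ B ] 0ℚ ℚ.< B × ∃[ N ] (∀ n → N ℕ.≤ n → ∣ seq x n ∣ ℚ.≤ B)
    bounded x with cauchy x 1ℚ 0<1
    ... | N , close = ∣ c ∣ ℚ.+ 1ℚ , 0<B , N , ≤B
      where
      c : ℚ
      c = seq x N
      0<B : 0ℚ ℚ.< ∣ c ∣ ℚ.+ 1ℚ
      0<B = ℚ.+-mono-≤-< (ℚ.0≤∣p∣ c) 0<1
      open +-*-Solver
      open ℚ.≤-Reasoning
      ≤B : ∀ n → N ℕ.≤ n → ∣ seq x n ∣ ℚ.≤ ∣ c ∣ ℚ.+ 1ℚ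
      ≤B n N≤n = begin
        ∣ seq x n ∣                    ≡⟨ cong ∣_∣ (solve 2 (λ p q → p := q :+ (p :- q)) refl (seq x n) c) ⟩
        ∣ c ℚ.+ (seq x n ℚ.- c) ∣      ≤⟨ ℚ.∣p+q∣≤∣p∣+∣q∣ c (seq x n ℚ.- c) ⟩
        ∣ c ∣ ℚ.+ ∣ seq x n ℚ.- c ∣    ≤⟨ ℚ.+-monoʳ-≤ ∣ c ∣ (ℚ.<⇒≤ (close n N N≤n ℕ.≤-refl)) ⟩
        ∣ c ∣ ℚ.+ 1ℚ                   ∎

  lipschitz⇒cauchy : (f : ℚ → ℚ → ℚ) (x y : ℝ) (K L : ℚ) → 0ℚ ℚ.< K → 0ℚ ℚ.< L →
    (N : ℕ) →
    (∀ m n → N ℕ.≤ m → N ℕ.≤ n →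
      ∣ f (seq x m) (seq y m) ℚ.- f (seq x n) (seq y n) ∣
        ℚ.≤ K ℚ.* ∣ seq x m ℚ.- seq x n ∣ ℚ.+ L ℚ.* ∣ seq y m ℚ.- seq y n ∣) →
    IsCauchy (λ n → f (seq x n) (seq y n))
  lipschitz⇒cauchy f x y K L 0<K 0<L N lip ε 0<ε
    with scale K 0<K (½ ℚ.* ε) (0<½* ε 0<ε) | scale L 0<L (½ ℚ.* ε) (0<½* ε 0<ε)
  ... | δ , 0<δ , Kδ | η , 0<η , Lη with cauchy x δ 0<δ | cauchy y η 0<η
  ... | N₁ , close₁ | N₂ , close₂ = N ℕ.⊔ (N₁ ℕ.⊔ N₂) , close
    where
    M = N ℕ.⊔ (N₁ ℕ.⊔ N₂)
    N≤M  : N ℕ.≤ M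
    N≤M  = ℕ.m≤m⊔n N _
    N₁≤M : N₁ ℕ.≤ M
    N₁≤M = ℕ.≤-trans (ℕ.m≤m⊔n N₁ N₂) (ℕ.m≤n⊔m N _)
    N₂≤M : N₂ ℕ.≤ M
    N₂≤M = ℕ.≤-trans (ℕ.m≤n⊔m N₁ N₂) (ℕ.m≤n⊔m N _)
    open ℚ.≤-Reasoning
    close : ∀ m n → M ℕ.≤ m → M ℕ.≤ n →
            ∣ f (seq x m) (seq y m) ℚ.- f (seq x n) (seq y n) ∣ ℚ.< ε
    close m n M≤m M≤n = begin-strict
      ∣ f (seq x m) (seq y m) ℚ.- f (seq x n) (seq y n) ∣
        ≤⟨ lip m n (ℕ.≤-trans N≤M M≤m) (ℕ.≤-trans N≤M M≤n) ⟩
      K ℚ.* ∣ seq x m ℚ.- seq x n ∣ ℚ.+ L ℚ.* ∣ seq y m ℚ.- seq y n ∣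
        <⟨ ℚ.+-mono-<
             (Kδ _ (close₁ m n (ℕ.≤-trans N₁≤M M≤m) (ℕ.≤-trans N₁≤M M≤n)))
             (Lη _ (close₂ m n (ℕ.≤-trans N₂≤M M≤m) (ℕ.≤-trans N₂≤M M≤n))) ⟩
      ½ ℚ.* ε ℚ.+ ½ ℚ.* ε   ≡⟨ ℚ.*-distribʳ-+ ε ½ ½ ⟨
      1ℚ ℚ.* ε              ≡⟨ ℚ.*-identityˡ ε ⟩
      ε                     ∎

  *-cauchy : (x y : ℝ) → IsCauchy (λ n → seq x n ℚ.* seq y n)
  *-cauchy x y =
    let A , 0<A , N₁ , ≤A = bounded x
        B , 0<B , N₂ , ≤B = bounded y
    in lipschitz⇒cauchy ℚ._*_ x y B A 0<B 0<A (N₁ ℕ.⊔ N₂) λ m n M≤m M≤n →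
      *-lip (seq x m) (seq x n) (seq y m) (seq y n) A B
        (≤A m (ℕ.≤-trans (ℕ.m≤m⊔n N₁ N₂) M≤m))
        (≤B n (ℕ.≤-trans (ℕ.m≤n⊔m N₁ N₂) M≤n))

fromℚ : ℚ → ℝ
fromℚ q = mkℝ (λ _ → q) λ ε 0<ε → 0 , λ _ _ _ _ →
  subst (λ r → ∣ r ∣ ℚ.< ε) (sym (ℚ.+-inverseʳ q)) 0<ε

0ℝ 1ℝ : ℝ
0ℝ = fromℚ 0ℚ
1ℝ = fromℚ 1ℚ

infixl 6 _+_ _⊔_ _⊓_
infixl 7 _*_ _/_

_+_ _⊔_ _⊓_ _*_ : ℝ → ℝ → ℝ
x + y = mkℝ (λ n → seq x n ℚ.+ seq y n)
  (lipschitz⇒cauchy ℚ._+_ x y 1ℚ 1ℚ 0<1 0<1 0 λ m n _ _ →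
    +-lip (seq x m) (seq x n) (seq y m) (seq y n))
x ⊔ y = mkℝ (λ n → seq x n ℚ.⊔ seq y n)
  (lipschitz⇒cauchy ℚ._⊔_ x y 1ℚ 1ℚ 0<1 0<1 0 λ m n _ _ →
    symm-lip ℚ._⊔_ ⊔-lip₁ (seq x m) (seq x n) (seq y m) (seq y n))
x ⊓ y = mkℝ (λ n → seq x n ℚ.⊓ seq y n)
  (lipschitz⇒cauchy ℚ._⊓_ x y 1ℚ 1ℚ 0<1 0<1 0 λ m n _ _ →
    symm-lip ℚ._⊓_ ⊓-lip₁ (seq x m) (seq x n) (seq y m) (seq y n))
x * y = mkℝ (λ n → seq x n ℚ.* seq y n) (*-cauchy x y)

_/_ : ℝ → (n : ℕ) .{{_ : NonZero n}} → ℝ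
x / n = x * fromℚ (+ 1 ℚ./ n)

sumBelow : ℕ → (ℕ → ℝ) → ℝ
sumBelow zero    f = 0ℝ
sumBelow (suc n) f = sumBelow n f + f n

maximum minimum : ∀ {n} .{{_ : NonZero n}} → (Fin n → ℝ) → ℝ
maximum {suc zero}    f = f zero
maximum {suc (suc n)} f = f zero ⊔ maximum (f ∘ suc)
minimum {suc zero}    f = f zero
minimum {suc (suc n)} f = f zero ⊓ minimum (f ∘ suc)

-- x ≤sup S and x <sup S compare x with the supremum of S without requiring
-- that supremum to exist as an element of ℝ, which constructively it may not.
-- If σ is the least upper bound of S, they mean x ≤ σ and x < σ.

infix 4 _≤sup_ _<sup_

_≤sup_ _<sup_ : ℝ → (ℝ → Set) → Set
x ≤sup S = ∀ r → r < x → ∃[ s ] S s × r < s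
x <sup S = ∃[ s ] S s × x < s

------------------------------------------------------------------------
-- Ordinal makespan scheduling; j : ℕ stands for the job with index j + 1

record Realization : Set where
  field
    size       : ℕ → ℝ
    nonNeg     : ∀ j → 0ℝ ≤ size j
    decreasing : ∀ j → size (suc j) ≤ size j
    bound      : ℕ
    finite     : ∀ j → bound ℕ.≤ j → size j ≃ 0ℝ

open Realization public

-- The partition J₁, …, Jₘ is given by sending each job to its machine.
Solution : ℕ → Set
Solution m = ℕ → Fin m

module _ {m : ℕ} where

  load : Realization → Solution m → Fin m → ℝ
  load p s i =
    sumBelow (bound p) λ j → if does (s j Fin.≟ i) then size p j else 0ℝ

  module _ .{{_ : NonZero m}} where

    completionTime : Realization → Solution m → ℝ
    completionTime p s = maximum (load p s)

    IsOptimum : Realization → ℝ → Set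
    IsOptimum p λ* = (∃[ s ] completionTime p s ≃ λ*)
                   × (∀ s → λ* ≤ completionTime p s)

Algorithm : (m M : ℕ) → Set
Algorithm m M = Fin M → Solution m

module _ {m M : ℕ} .{{_ : NonZero m}} .{{_ : NonZero M}} where

  makespan : Algorithm m M → Realization → ℝ
  makespan A p = minimum λ k → completionTime p (A k)

  -- Ratios A ρ: ρ is the quotient makespan / λ* for some realization with λ* > 0.
  -- The competitive ratio of A is the supremum of Ratios A.
  Ratios : Algorithm m M → ℝ → Set
  Ratios A ρ = ∃[ p ] ∃[ λ* ] IsOptimum {m} p λ* × 0ℝ < λ* × ρ * λ* ≃ makespan A p

{-# OPTIONS --safe #-}

-- For k ≥ 1 let Rₖ consist of k jobs of size k + 1 followed by k + 1 jobs of
-- size k, so that the optimum is k (k + 1).  A solution is optimal for Rₖ only if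
-- it keeps the first k jobs together and puts job k + 1 on the other machine.
-- These requirements are incompatible for different k, so among k = 1, …, M + 1
-- there is one for which none of the M solutions is optimal; as sizes are
-- integers, the ratio on Rₖ is then at least 1 + 1 / (k (k + 1)) ≥ 1 + 1 / (6 M²).

module Submission where

open import Defs
open import Data.Nat as ℕ using (ℕ; zero; suc; NonZero; _^_; _∸_)
open import Data.Nat.Properties as ℕ using (m^n≢0)
open import Data.Nat.Tactic.RingSolver using (solve-∀)
open import Data.Integer as ℤ using (+_)
import Data.Integer.Properties as ℤ
open import Data.Rational as ℚ using (ℚ; 0ℚ; 1ℚ; fromℚᵘ)
import Data.Rational.Properties as ℚ
open import Data.Rational.Unnormalised as ℚᵘ using (mkℚᵘ; *≡*; *≤*; *<*)
import Data.Rational.Unnormalised.Properties as ℚᵘ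
open import Data.Bool using (true; false; if_then_else_)
open import Data.Fin using (Fin; zero; suc; toℕ)
import Data.Fin.Properties as Fin
open import Data.Product using (∃-syntax; _×_; _,_; proj₁; proj₂)
open import Data.Sum using (inj₁; inj₂)
open import Function using (_∘_; const)
open import Relation.Nullary using (¬_; ¬?; yes; no; does; contradiction)
open import Relation.Binary.PropositionalEquality
  using (_≡_; _≢_; refl; sym; trans; cong; cong₂; subst; module ≡-Reasoning)

-- Loads for natural job sizes

module _ {m : ℕ} (s : Solution m) (i : Fin m) where

  -- Mirrors the recursion behind `load`, so that the combinatorics can be done in `ℕ` and carried
  -- over to `ℝ` by `seq-sumBelow`.
  loadℕ : (ℕ → ℕ) → ℕ → ℕ
  loadℕ w zero    = 0
  loadℕ w (suc n) = loadℕ w n ℕ.+ (if does (s n Fin.≟ i) then w n else 0)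

  count : ℕ → ℕ
  count = loadℕ (const 1)

  count-suc-≡ : ∀ n → s n ≡ i → count (suc n) ≡ suc (count n)
  count-suc-≡ n sn≡i with s n Fin.≟ i
  ... | yes _   = ℕ.+-comm (count n) 1
  ... | no sn≢i = contradiction sn≡i sn≢i

  count-suc-≢ : ∀ n → s n ≢ i → count (suc n) ≡ count n
  count-suc-≢ n sn≢i with s n Fin.≟ i
  ... | yes sn≡i = contradiction sn≡i sn≢i
  ... | no _     = ℕ.+-identityʳ (count n)

  count-suc-≤ : ∀ n → count (suc n) ℕ.≤ suc (count n)
  count-suc-≤ n with s n Fin.≟ i
  ... | yes _ = ℕ.≤-reflexive (ℕ.+-comm (count n) 1)
  ... | no _  = ℕ.≤-trans (ℕ.≤-reflexive (ℕ.+-identityʳ _)) (ℕ.n≤1+n _)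

  count≤n : ∀ n → count n ℕ.≤ n
  count≤n zero    = ℕ.z≤n
  count≤n (suc n) = ℕ.≤-trans (count-suc-≤ n) (ℕ.s≤s (count≤n n))

  count-mono : ∀ d n → count n ℕ.≤ count (d ℕ.+ n)
  count-mono zero    n = ℕ.≤-refl
  count-mono (suc d) n = ℕ.≤-trans (count-mono d n) (ℕ.m≤m+n _ _)

  -- Each job adds at most one to the count, so a count that reaches `n` leaves no room for a job
  -- placed elsewhere.
  n≤count⇒≡ : ∀ {n} → n ℕ.≤ count n → ∀ {j} → j ℕ.< n → s j ≡ i
  n≤count⇒≡ {suc n} n<c {j} j<1+n with s n Fin.≟ i
  ... | no _ = contradiction (count≤n n)
          (ℕ.<⇒≱ (subst (suc n ℕ.≤_) (ℕ.+-identityʳ _) n<c))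
  ... | yes sn≡i with ℕ.m≤n⇒m<n∨m≡n (ℕ.s≤s⁻¹ j<1+n)
  ...   | inj₁ j<n  = n≤count⇒≡ (ℕ.s≤s⁻¹ (subst (suc n ℕ.≤_) (ℕ.+-comm _ 1) n<c)) j<n
  ...   | inj₂ refl = sn≡i

  -- Linearity of the load in the sizes; it splits the load under `weight k` into two counts.
  loadℕ-+* : ∀ v k w n →
    loadℕ (λ j → v j ℕ.+ k ℕ.* w j) n ≡ loadℕ v n ℕ.+ k ℕ.* loadℕ w n
  loadℕ-+* v k w zero = sym (ℕ.*-zeroʳ k)
  loadℕ-+* v k w (suc n) with does (s n Fin.≟ i)
  ... | true  = trans (cong (ℕ._+ (v n ℕ.+ k ℕ.* w n)) (loadℕ-+* v k w n))
                      (rearrange (loadℕ v n) k (loadℕ w n) (v n) (w n))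
    where
    rearrange : ∀ a k b x y →
      a ℕ.+ k ℕ.* b ℕ.+ (x ℕ.+ k ℕ.* y) ≡ a ℕ.+ x ℕ.+ k ℕ.* (b ℕ.+ y)
    rearrange = solve-∀
  ... | false = trans (cong (ℕ._+ 0) (loadℕ-+* v k w n))
                      (rearrange (loadℕ v n) k (loadℕ w n))
    where
    rearrange : ∀ a k b → a ℕ.+ k ℕ.* b ℕ.+ 0 ≡ a ℕ.+ 0 ℕ.+ k ℕ.* (b ℕ.+ 0)
    rearrange = solve-∀

-- Indicator of `j < k`; the closed form inherits monotonicity from `⊓` and `∸`.
below : ℕ → ℕ → ℕ
below k j = 1 ℕ.⊓ (k ∸ j)

below-antitone : ∀ k j → below k (suc j) ℕ.≤ below k j
below-antitone k j = ℕ.⊓-monoʳ-≤ 1 (ℕ.∸-monoʳ-≤ k (ℕ.n≤1+n j))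

below-< : ∀ {k j} → j ℕ.< k → below k j ≡ 1
below-< j<k = ℕ.m≤n⇒m⊓n≡m (ℕ.m<n⇒0<n∸m j<k)

below-≥ : ∀ {k j} → k ℕ.≤ j → below k j ≡ 0
below-≥ k≤j = cong (1 ℕ.⊓_) (ℕ.m≤n⇒m∸n≡0 k≤j)

loadℕ-below : ∀ {m} (s : Solution m) i k n →
  loadℕ s i (below k) n ≡ count s i (n ℕ.⊓ k)
loadℕ-below s i k zero = refl
loadℕ-below s i k (suc n) with n ℕ.<? k
... | yes n<k
  rewrite loadℕ-below s i k n | ℕ.m≤n⇒m⊓n≡m (ℕ.<⇒≤ n<k) | ℕ.m≤n⇒m⊓n≡m n<k
        | below-< n<k = refl
... | no n≮k
  rewrite loadℕ-below s i k n | ℕ.m≥n⇒m⊓n≡n (ℕ.≮⇒≥ n≮k)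
        | ℕ.m≥n⇒m⊓n≡n (ℕ.m≤n⇒m≤1+n (ℕ.≮⇒≥ n≮k)) | below-≥ (ℕ.≮⇒≥ n≮k)
  with does (s n Fin.≟ i)
... | true  = ℕ.+-identityʳ _
... | false = ℕ.+-identityʳ _

count₀+count₁ : ∀ s n → count s (zero {1}) n ℕ.+ count s (suc zero) n ≡ n
count₀+count₁ s zero = refl
count₀+count₁ s (suc n) with s n
... | zero     = trans (rearrange (count s zero n) (count s (suc zero) n))
                       (cong suc (count₀+count₁ s n))
  where
  rearrange : ∀ a b → a ℕ.+ 1 ℕ.+ (b ℕ.+ 0) ≡ suc (a ℕ.+ b)
  rearrange = solve-∀
... | suc zero = trans (rearrange (count s zero n) (count s (suc zero) n))
                       (cong suc (count₀+count₁ s n))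
  where
  rearrange : ∀ a b → a ℕ.+ 0 ℕ.+ (b ℕ.+ 1) ≡ suc (a ℕ.+ b)
  rearrange = solve-∀

-- The realizations Rₖ

jobs : ℕ → ℕ
jobs k = k ℕ.+ suc k

-- Equals `suc k` on the first `k` jobs, `k` on the next `suc k`, and zero afterwards.
weight : ℕ → ℕ → ℕ
weight k j = below k j ℕ.+ k ℕ.* below (jobs k) j

-- Half of the total size `k * suc k + suc k * k`.
opt : ℕ → ℕ
opt k = k ℕ.* suc k

weight-antitone : ∀ k j → weight k (suc j) ℕ.≤ weight k j
weight-antitone k j =
  ℕ.+-mono-≤ (below-antitone k j) (ℕ.*-monoʳ-≤ k (below-antitone (jobs k) j))

weight-≥ : ∀ k j → jobs k ℕ.≤ j → weight k j ≡ 0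
weight-≥ k j N≤j
  rewrite below-≥ {k} (ℕ.≤-trans (ℕ.m≤m+n k (suc k)) N≤j) | below-≥ N≤j = ℕ.*-zeroʳ k

loadR : ∀ {m} → ℕ → Solution m → Fin m → ℕ
loadR k s i = loadℕ s i (weight k) (jobs k)

loadR-count : ∀ {m} k (s : Solution m) i →
  loadR k s i ≡ count s i k ℕ.+ k ℕ.* count s i (jobs k)
loadR-count k s i = begin
  loadR k s i
    ≡⟨ loadℕ-+* s i (below k) k (below (jobs k)) (jobs k) ⟩
  loadℕ s i (below k) (jobs k) ℕ.+ k ℕ.* loadℕ s i (below (jobs k)) (jobs k)
    ≡⟨ cong₂ (λ a b → a ℕ.+ k ℕ.* b) (loadℕ-below s i k (jobs k))
             (loadℕ-below s i (jobs k) (jobs k)) ⟩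
  count s i (jobs k ℕ.⊓ k) ℕ.+ k ℕ.* count s i (jobs k ℕ.⊓ jobs k)
    ≡⟨ cong₂ (λ a b → count s i a ℕ.+ k ℕ.* count s i b)
             (ℕ.m≥n⇒m⊓n≡n (ℕ.m≤m+n k (suc k))) (ℕ.⊓-idem (jobs k)) ⟩
  count s i k ℕ.+ k ℕ.* count s i (jobs k) ∎
  where open ≡-Reasoning

loadR₀+loadR₁ : ∀ k s → loadR k s (zero {1}) ℕ.+ loadR k s (suc zero) ≡ opt k ℕ.+ opt k
loadR₀+loadR₁ k s = begin
  loadR k s zero ℕ.+ loadR k s (suc zero)
    ≡⟨ cong₂ ℕ._+_ (loadR-count k s zero) (loadR-count k s (suc zero)) ⟩
  (a₀ ℕ.+ k ℕ.* b₀) ℕ.+ (a₁ ℕ.+ k ℕ.* b₁)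
    ≡⟨ regroup a₀ a₁ b₀ b₁ k ⟩
  (a₀ ℕ.+ a₁) ℕ.+ k ℕ.* (b₀ ℕ.+ b₁)
    ≡⟨ cong₂ (λ a b → a ℕ.+ k ℕ.* b) (count₀+count₁ s k) (count₀+count₁ s (jobs k)) ⟩
  k ℕ.+ k ℕ.* (k ℕ.+ suc k)
    ≡⟨ total k ⟩
  opt k ℕ.+ opt k ∎
  where
  open ≡-Reasoning
  a₀ = count s zero k
  a₁ = count s (suc zero) k
  b₀ = count s zero (jobs k)
  b₁ = count s (suc zero) (jobs k)
  regroup : ∀ a₀ a₁ b₀ b₁ k → (a₀ ℕ.+ k ℕ.* b₀) ℕ.+ (a₁ ℕ.+ k ℕ.* b₁)
                            ≡ (a₀ ℕ.+ a₁) ℕ.+ k ℕ.* (b₀ ℕ.+ b₁)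
  regroup = solve-∀
  total : ∀ k → k ℕ.+ k ℕ.* (k ℕ.+ suc k) ≡ k ℕ.* suc k ℕ.+ k ℕ.* suc k
  total = solve-∀

-- Optimal solutions for Rₖ and their incompatibility

maxLoadR : ℕ → Solution 2 → ℕ
maxLoadR k s = loadR k s zero ℕ.⊔ loadR k s (suc zero)

-- Machine `zero` suffices: the total is `opt k + opt k`, so the other load is then `opt k` too. The
-- equation is decidable, which `unbalanced-index` exploits.
Balanced : ℕ → Solution 2 → Set
Balanced k s = loadR k s zero ≡ opt k

-- Two loads below `opt k` would sum to less than the total.
opt≤maxLoadR : ∀ k s → opt k ℕ.≤ maxLoadR k s
opt≤maxLoadR k s with opt k ℕ.≤? maxLoadR k s
... | yes p = p
... | no ¬p = contradiction (loadR₀+loadR₁ k s) (ℕ.<⇒≢ (ℕ.+-mono-<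
        (ℕ.≤-<-trans (ℕ.m≤m⊔n _ _) (ℕ.≰⇒> ¬p))
        (ℕ.≤-<-trans (ℕ.m≤n⊔m (loadR k s zero) _) (ℕ.≰⇒> ¬p))))

maxLoadR≤opt⇒balanced : ∀ k s → maxLoadR k s ℕ.≤ opt k → Balanced k s
maxLoadR≤opt⇒balanced k s p with ℕ.m≤n⇒m<n∨m≡n (ℕ.m⊔n≤o⇒m≤o (loadR k s zero) _ p)
... | inj₂ eq = eq
... | inj₁ lt = contradiction (loadR₀+loadR₁ k s)
        (ℕ.<⇒≢ (ℕ.+-mono-<-≤ lt (ℕ.m⊔n≤o⇒n≤o (loadR k s zero) _ p)))

balanced⇒loadR₁≡opt : ∀ k s → Balanced k s → loadR k s (suc zero) ≡ opt k
balanced⇒loadR₁≡opt k s bal = ℕ.+-cancelˡ-≡ (opt k) _ _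
  (trans (cong (ℕ._+ loadR k s (suc zero)) (sym bal)) (loadR₀+loadR₁ k s))

balanced⇒maxLoadR≡opt : ∀ k s → Balanced k s → maxLoadR k s ≡ opt k
balanced⇒maxLoadR≡opt k s bal = trans (cong₂ ℕ._⊔_ bal (balanced⇒loadR₁≡opt k s bal)) (ℕ.⊔-idem (opt k))

-- Indices start at zero, so `s k` is the machine of the first small job.
Separating : ℕ → Solution 2 → Fin 2 → Set
Separating k s i = (∀ {j} → j ℕ.< k → s j ≡ i) × s k ≢ i

-- The machine that gets at most k of the 2 k + 1 jobs misses the load k (k + 1)
-- unless it gets k large ones, hence all of them.
minority⇒separating : ∀ k s i → loadR k s i ≡ opt k → count s i (jobs k) ℕ.≤ k →
                      Separating k s i
minority⇒separating k s i load≡opt cN≤k = n≤count⇒≡ s i k≤ck , sk≢i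
  where
  open ℕ.≤-Reasoning
  k≤ck : k ℕ.≤ count s i k
  k≤ck = ℕ.+-cancelʳ-≤ (k ℕ.* k) _ _ (begin
    k ℕ.+ k ℕ.* k                              ≡⟨ ℕ.*-suc k k ⟨
    opt k                                      ≡⟨ load≡opt ⟨
    loadR k s i                                ≡⟨ loadR-count k s i ⟩
    count s i k ℕ.+ k ℕ.* count s i (jobs k)   ≤⟨ ℕ.+-monoʳ-≤ (count s i k) (ℕ.*-monoʳ-≤ k cN≤k) ⟩
    count s i k ℕ.+ k ℕ.* k                    ∎)
  sk≢i : s k ≢ i
  sk≢i sk≡i = ℕ.<-irrefl refl (begin-strict
    k                          ≤⟨ k≤ck ⟩
    count s i k                <⟨ ℕ.n<1+n _ ⟩
    suc (count s i k)          ≡⟨ count-suc-≡ s i k sk≡i ⟨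
    count s i (suc k)          ≤⟨ count-mono s i k (suc k) ⟩
    count s i (jobs k)         ≤⟨ cN≤k ⟩
    k                          ∎)

-- The number of jobs is odd, so one machine gets at most `k` of them; balance gives it the load
-- `opt k`, whichever machine it is.
balanced⇒separating : ∀ k s → Balanced k s → ∃[ i ] Separating k s i
balanced⇒separating k s bal with count s zero (jobs k) ℕ.≤? k
... | yes c₀≤k = zero , minority⇒separating k s zero bal c₀≤k
... | no c₀≰k  = suc zero , minority⇒separating k s (suc zero) (balanced⇒loadR₁≡opt k s bal) c₁≤k
  where
  open ℕ.≤-Reasoning
  c₁≤k : count s (suc zero) (jobs k) ℕ.≤ k
  c₁≤k = ℕ.+-cancelˡ-≤ (suc k) _ _ (begin
    suc k ℕ.+ count s (suc zero) (jobs k)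
      ≤⟨ ℕ.+-monoˡ-≤ _ (ℕ.≰⇒> c₀≰k) ⟩
    count s zero (jobs k) ℕ.+ count s (suc zero) (jobs k)
      ≡⟨ count₀+count₁ s (jobs k) ⟩
    k ℕ.+ suc k
      ≡⟨ ℕ.+-comm k (suc k) ⟩
    suc k ℕ.+ k ∎)

-- Balance for `l` puts the jobs `0` and `k`, both below `l`, on one machine; balance for `k`
-- separates them.
balanced-unique : ∀ {k l} s → 0 ℕ.< k → k ℕ.< l → Balanced k s → ¬ Balanced l s
balanced-unique {k} {l} s 0<k k<l bk bl
  with balanced⇒separating k s bk | balanced⇒separating l s bl
... | _ , first , last≢ | _ , first′ , _ =
  last≢ (trans (first′ k<l) (trans (sym (first′ (ℕ.<-trans 0<k k<l))) (first 0<k)))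

-- Otherwise each of the `suc M` candidates has a balanced solution among only `M`; by pigeonhole
-- two candidates share one, against `balanced-unique`.
unbalanced-index : ∀ {M} (A : Algorithm 2 M) →
  ∃[ k ] k ℕ.≤ M × (∀ a → ¬ Balanced (suc k) (A a))
unbalanced-index {M} A
  -- A finite search over decidable equations supplies the witness; pigeonhole only rules out its
  -- failure.
  with Fin.any? {n = suc M} (λ i → Fin.all? λ a →
         ¬? (loadR (suc (toℕ i)) (A a) zero ℕ.≟ opt (suc (toℕ i))))
... | yes (i , p) = toℕ i , ℕ.s≤s⁻¹ (Fin.toℕ<n i) , p
... | no ¬p = contradiction (Fin.pigeonhole (ℕ.n<1+n M) (proj₁ ∘ balancer)) λ where
    (i , j , i<j , eq) → balanced-unique (A (proj₁ (balancer i))) (ℕ.s≤s ℕ.z≤n) (ℕ.s≤s i<j)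
      (proj₂ (balancer i))
      (subst (Balanced (suc (toℕ j)) ∘ A) (sym eq) (proj₂ (balancer j)))
  where
  balancer : ∀ i → ∃[ a ] Balanced (suc (toℕ {suc M} i)) (A a)
  balancer i with Fin.any? (λ a → loadR (suc (toℕ i)) (A a) zero ℕ.≟ opt (suc (toℕ i)))
  ... | yes q = q
  ... | no ¬q = contradiction (i , λ a b → ¬q (a , b)) ¬p

-- A solution attaining `opt k`

split : ℕ → Solution 2
split k j with j ℕ.<? k
... | yes _ = zero
... | no _  = suc zero

split-count-≤ : ∀ k n → n ℕ.≤ k → count (split k) zero n ≡ n
split-count-≤ k zero n≤k = refl
split-count-≤ k (suc n) n<k =
  trans (count-suc-≡ (split k) zero n split≡) (cong suc (split-count-≤ k n (ℕ.<⇒≤ n<k)))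
  where
  split≡ : split k n ≡ zero
  split≡ with n ℕ.<? k
  ... | yes _  = refl
  ... | no n≮k = contradiction n<k n≮k

split-count-+ : ∀ k d → count (split k) zero (d ℕ.+ k) ≡ k
split-count-+ k zero = split-count-≤ k k ℕ.≤-refl
split-count-+ k (suc d) =
  trans (count-suc-≢ (split k) zero (d ℕ.+ k) split≢) (split-count-+ k d)
  where
  split≢ : split k (d ℕ.+ k) ≢ zero
  split≢ with (d ℕ.+ k) ℕ.<? k
  ... | yes lt = contradiction (ℕ.m≤n+m k d) (ℕ.<⇒≱ lt)
  ... | no _   = λ ()

-- Machine `zero` holds exactly the `k` large jobs, each of size `suc k`.
split-balanced : ∀ k → Balanced k (split k)
split-balanced k = begin
  loadR k (split k) zero
    ≡⟨ loadR-count k (split k) zero ⟩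
  count (split k) zero k ℕ.+ k ℕ.* count (split k) zero (jobs k)
    ≡⟨ cong (λ n → count (split k) zero k ℕ.+ k ℕ.* count (split k) zero n) (ℕ.+-comm k (suc k)) ⟩
  count (split k) zero k ℕ.+ k ℕ.* count (split k) zero (suc k ℕ.+ k)
    ≡⟨ cong₂ (λ a b → a ℕ.+ k ℕ.* b) (split-count-+ k 0) (split-count-+ k (suc k)) ⟩
  k ℕ.+ k ℕ.* k
    ≡⟨ ℕ.*-suc k k ⟨
  opt k ∎
  where open ≡-Reasoning

-- Natural numbers and unit fractions in ℚ

-- `toℚᵘ` is injective, respects sums and undoes `fromℚᵘ` up to equivalence.
fromℚᵘ-homo-+ : ∀ p q → fromℚᵘ (p ℚᵘ.+ q) ≡ fromℚᵘ p ℚ.+ fromℚᵘ q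
fromℚᵘ-homo-+ p q = ℚ.toℚᵘ-injective (ℚᵘ.≃-trans (ℚ.toℚᵘ-fromℚᵘ (p ℚᵘ.+ q))
  (ℚᵘ.≃-sym (ℚᵘ.≃-trans (ℚ.toℚᵘ-homo-+ (fromℚᵘ p) (fromℚᵘ q))
    (ℚᵘ.+-cong (ℚ.toℚᵘ-fromℚᵘ p) (ℚ.toℚᵘ-fromℚᵘ q)))))

fromℚᵘ-homo-* : ∀ p q → fromℚᵘ (p ℚᵘ.* q) ≡ fromℚᵘ p ℚ.* fromℚᵘ q
fromℚᵘ-homo-* p q = ℚ.toℚᵘ-injective (ℚᵘ.≃-trans (ℚ.toℚᵘ-fromℚᵘ (p ℚᵘ.* q))
  (ℚᵘ.≃-sym (ℚᵘ.≃-trans (ℚ.toℚᵘ-homo-* (fromℚᵘ p) (fromℚᵘ q))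
    (ℚᵘ.*-cong (ℚ.toℚᵘ-fromℚᵘ p) (ℚ.toℚᵘ-fromℚᵘ q)))))

fromℚᵘ-mono-≤ : ∀ {p q} → p ℚᵘ.≤ q → fromℚᵘ p ℚ.≤ fromℚᵘ q
fromℚᵘ-mono-≤ {p} {q} p≤q = ℚ.toℚᵘ-cancel-≤
  (ℚᵘ.≤-respˡ-≃ (ℚᵘ.≃-sym (ℚ.toℚᵘ-fromℚᵘ p))
    (ℚᵘ.≤-respʳ-≃ (ℚᵘ.≃-sym (ℚ.toℚᵘ-fromℚᵘ q)) p≤q))

fromℚᵘ-mono-< : ∀ {p q} → p ℚᵘ.< q → fromℚᵘ p ℚ.< fromℚᵘ q
fromℚᵘ-mono-< {p} {q} p<q = ℚ.toℚᵘ-cancel-<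
  (ℚᵘ.<-respˡ-≃ (ℚᵘ.≃-sym (ℚ.toℚᵘ-fromℚᵘ p))
    (ℚᵘ.<-respʳ-≃ (ℚᵘ.≃-sym (ℚ.toℚᵘ-fromℚᵘ q)) p<q))

-- Abstract, so that normalisation to lowest terms is never unfolded during conversion.
abstract
  ι : ℕ → ℚ
  ι n = + n ℚ./ 1

  1/suc : ℕ → ℚ
  1/suc d = + 1 ℚ./ suc d

  ι-0 : ι 0 ≡ 0ℚ
  ι-0 = refl

  ι-1 : ι 1 ≡ 1ℚ
  ι-1 = refl

  ι-homo-+ : ∀ m n → ι (m ℕ.+ n) ≡ ι m ℚ.+ ι n
  ι-homo-+ m n = trans
    (ℚ.fromℚᵘ-cong {mkℚᵘ (+ (m ℕ.+ n)) 0} {mkℚᵘ (+ m) 0 ℚᵘ.+ mkℚᵘ (+ n) 0} (*≡* (cong (ℤ._* (+ 1))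
      (sym (cong₂ ℤ._+_ (ℤ.*-identityʳ (+ m)) (ℤ.*-identityʳ (+ n)))))))
    (fromℚᵘ-homo-+ (mkℚᵘ (+ m) 0) (mkℚᵘ (+ n) 0))

  ι-mono-≤ : ∀ {m n} → m ℕ.≤ n → ι m ℚ.≤ ι n
  ι-mono-≤ {m} {n} m≤n = fromℚᵘ-mono-≤ {mkℚᵘ (+ m) 0} {mkℚᵘ (+ n) 0}
    (*≤* (ℤ.*-monoʳ-≤-nonNeg (+ 1) (ℤ.+≤+ m≤n)))

  ι-pos : ∀ n → 0ℚ ℚ.< ι (suc n)
  ι-pos n = fromℚᵘ-mono-< {mkℚᵘ (+ 0) 0} {mkℚᵘ (+ suc n) 0} (*<* (ℤ.+<+ (ℕ.s≤s ℕ.z≤n)))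

  1/suc-def : ∀ d → 1/suc d ≡ + 1 ℚ./ suc d
  1/suc-def d = refl

  1/suc-pos : ∀ d → 0ℚ ℚ.< 1/suc d
  1/suc-pos d = fromℚᵘ-mono-< {mkℚᵘ (+ 0) 0} {mkℚᵘ (+ 1) d} (*<* (ℤ.+<+ (ℕ.s≤s ℕ.z≤n)))

  1/suc-antitone : ∀ {d e} → d ℕ.≤ e → 1/suc e ℚ.≤ 1/suc d
  1/suc-antitone {d} {e} d≤e = fromℚᵘ-mono-≤ {mkℚᵘ (+ 1) e} {mkℚᵘ (+ 1) d}
    (*≤* (ℤ.*-monoˡ-≤-nonNeg (+ 1) (ℤ.+≤+ (ℕ.s≤s d≤e))))

  -- `suc d * suc e` reduces to `suc (e + d * suc e)`.
  1/suc-* : ∀ d e → 1/suc d ℚ.* 1/suc e ≡ 1/suc (e ℕ.+ d ℕ.* suc e)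
  1/suc-* d e = sym (fromℚᵘ-homo-* (mkℚᵘ (+ 1) d) (mkℚᵘ (+ 1) e))

  ι*1/suc : ∀ d → ι (suc d) ℚ.* 1/suc d ≡ 1ℚ
  ι*1/suc d = trans (sym (fromℚᵘ-homo-* (mkℚᵘ (+ suc d) 0) (mkℚᵘ (+ 1) d)))
    (ℚ.fromℚᵘ-cong {mkℚᵘ (+ suc d) 0 ℚᵘ.* mkℚᵘ (+ 1) d} {mkℚᵘ (+ 1) 0} (*≡* (cong +_ (unit d))))
    where
    unit : ∀ d → (suc d ℕ.* 1) ℕ.* 1 ≡ 1 ℕ.* (1 ℕ.* suc d)
    unit = solve-∀

ι-nonNeg : ∀ n → 0ℚ ℚ.≤ ι n
ι-nonNeg n = subst (ℚ._≤ ι n) ι-0 (ι-mono-≤ ℕ.z≤n)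

ι-homo-⊔ : ∀ m n → ι (m ℕ.⊔ n) ≡ ι m ℚ.⊔ ι n
ι-homo-⊔ m n with ℕ.≤-total m n
... | inj₁ m≤n = trans (cong ι (ℕ.m≤n⇒m⊔n≡n m≤n)) (sym (ℚ.p≤q⇒p⊔q≡q (ι-mono-≤ m≤n)))
... | inj₂ n≤m = trans (cong ι (ℕ.m≥n⇒m⊔n≡m n≤m)) (sym (ℚ.p≥q⇒p⊔q≡p (ι-mono-≤ n≤m)))

-- Real numbers with prescribed rational approximations

-- A witness of `y < x` would leave a positive gap at its index `N`, where the terms are ordered the
-- other way.
≤-pointwise : ∀ {x y} → (∀ n → seq x n ℚ.≤ seq y n) → x ≤ y
≤-pointwise {x} {y} x≤y (ε , 0<ε , N , y+ε≤x) =
  ℚ.<-irrefl refl (ℚ.<-≤-trans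
    (subst (ℚ._< seq y N ℚ.+ ε) (ℚ.+-identityʳ _) (ℚ.+-monoʳ-< (seq y N) 0<ε))
    (ℚ.≤-trans (y+ε≤x N ℕ.≤-refl) (x≤y N)))

≃-pointwise : ∀ {x y} → (∀ n → seq x n ≡ seq y n) → x ≃ y
≃-pointwise {x} {y} x≡y = ≤-pointwise {x} {y} (ℚ.≤-reflexive ∘ x≡y)
                        , ≤-pointwise {y} {x} (ℚ.≤-reflexive ∘ sym ∘ x≡y)

-- The values are constant natural numbers, so they can be compared decidably and a minimizing index
-- computed.
minimum-attained : ∀ {M} .{{_ : NonZero M}} (f : Fin M → ℝ) (g : Fin M → ℕ) →
  (∀ a n → seq (f a) n ≡ ι (g a)) → ∃[ a ] (∀ n → seq (minimum f) n ≡ ι (g a))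
minimum-attained {suc zero}    f g f≡g = zero , f≡g zero
minimum-attained {suc (suc M)} f g f≡g
  with minimum-attained (f ∘ suc) (g ∘ suc) (f≡g ∘ suc)
... | a , eq with ℕ.≤-total (g zero) (g (suc a))
...   | inj₁ le = zero , λ n → trans (cong₂ ℚ._⊓_ (f≡g zero n) (eq n)) (ℚ.p≤q⇒p⊓q≡p (ι-mono-≤ le))
...   | inj₂ ge = suc a , λ n → trans (cong₂ ℚ._⊓_ (f≡g zero n) (eq n)) (ℚ.p≥q⇒p⊓q≡q (ι-mono-≤ ge))

-- The realizations over `ℝ`, their optimum and the resulting ratio

R : ℕ → Realization
R k = record
  { size       = fromℚ ∘ ι ∘ weight k
  ; nonNeg     = λ j → ≤-pointwise {0ℝ} {fromℚ (ι (weight k j))} λ _ → ι-nonNeg (weight k j)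
  ; decreasing = λ j → ≤-pointwise {fromℚ (ι (weight k (suc j)))} {fromℚ (ι (weight k j))}
                         λ _ → ι-mono-≤ (weight-antitone k j)
  ; bound      = jobs k
  ; finite     = λ j N≤j → ≃-pointwise {fromℚ (ι (weight k j))} {0ℝ}
                             λ _ → trans (cong ι (weight-≥ k j N≤j)) ι-0
  }

-- Addition in `ℝ` is termwise, so the two recursions agree step by step.
seq-sumBelow : ∀ {m} (s : Solution m) i w N n →
  seq (sumBelow N λ j → if does (s j Fin.≟ i) then fromℚ (ι (w j)) else 0ℝ) n
    ≡ ι (loadℕ s i w N)
seq-sumBelow s i w zero    n = sym ι-0
seq-sumBelow s i w (suc N) n with does (s N Fin.≟ i)
... | true  = trans (cong (ℚ._+ ι (w N)) (seq-sumBelow s i w N n)) (sym (ι-homo-+ _ (w N)))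
... | false = trans (cong (ℚ._+ 0ℚ) (seq-sumBelow s i w N n)) (trans (cong (ι (loadℕ s i w N) ℚ.+_) (sym ι-0)) (sym (ι-homo-+ _ 0)))

seq-completionTime : ∀ k (s : Solution 2) n → seq (completionTime (R k) s) n ≡ ι (maxLoadR k s)
seq-completionTime k s n = trans
  (cong₂ ℚ._⊔_ (seq-sumBelow s zero (weight k) (jobs k) n)
               (seq-sumBelow s (suc zero) (weight k) (jobs k) n))
  (sym (ι-homo-⊔ (loadR k s zero) (loadR k s (suc zero))))

opt-isOptimum : ∀ k → IsOptimum {2} (R k) (fromℚ (ι (opt k)))
opt-isOptimum k
  = (split k , ≃-pointwise {completionTime (R k) (split k)} {fromℚ (ι (opt k))} λ n →
      trans (seq-completionTime k (split k) n)
            (cong ι (balanced⇒maxLoadR≡opt k (split k) (split-balanced k))))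
  , λ s → ≤-pointwise {fromℚ (ι (opt k))} {completionTime (R k) s} λ n →
      subst (ι (opt k) ℚ.≤_) (sym (seq-completionTime k s n)) (ι-mono-≤ (opt≤maxLoadR k s))

-- opt (suc k) is suc (pred-opt k) definitionally.
pred-opt : ℕ → ℕ
pred-opt k = suc k ℕ.+ k ℕ.* suc (suc k)

large-ratio : ∀ {M} .{{_ : NonZero M}} (A : Algorithm 2 M) k →
  (∀ a → ¬ Balanced (suc k) (A a)) →
  ∃[ q ] Ratios A (fromℚ q) × 1ℚ ℚ.+ 1/suc (pred-opt k) ℚ.≤ q
large-ratio A k unbalanced = ι μ ℚ.* 1/λ
  , ( R (suc k) , fromℚ (ι (opt (suc k))) , opt-isOptimum (suc k)
    -- The constant optimum itself serves as the gap above `0ℝ`.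
    , (ι (opt (suc k)) , ι-pos (pred-opt k) , 0 , λ _ _ → ℚ.≤-reflexive (ℚ.+-identityˡ _))
    , ≃-pointwise {fromℚ (ι μ ℚ.* 1/λ) * fromℚ (ι (opt (suc k)))} {makespan A (R (suc k))}
        λ n → trans ratio*λ≡μ (sym (proj₂ attained n)))
  , 1+1/λ≤ratio
  where
  attained : ∃[ a ] (∀ n → seq (makespan A (R (suc k))) n ≡ ι (maxLoadR (suc k) (A a)))
  attained = minimum-attained (completionTime (R (suc k)) ∘ A) (maxLoadR (suc k) ∘ A)
    (λ a → seq-completionTime (suc k) (A a))
  a = proj₁ attained
  μ = maxLoadR (suc k) (A a)
  1/λ = 1/suc (pred-opt k)
  ratio*λ≡μ : ι μ ℚ.* 1/λ ℚ.* ι (opt (suc k)) ≡ ι μ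
  ratio*λ≡μ = begin
    ι μ ℚ.* 1/λ ℚ.* ι (opt (suc k))     ≡⟨ ℚ.*-assoc (ι μ) 1/λ _ ⟩
    ι μ ℚ.* (1/λ ℚ.* ι (opt (suc k)))   ≡⟨ cong (ι μ ℚ.*_) (ℚ.*-comm 1/λ _) ⟩
    ι μ ℚ.* (ι (opt (suc k)) ℚ.* 1/λ)   ≡⟨ cong (ι μ ℚ.*_) (ι*1/suc (pred-opt k)) ⟩
    ι μ ℚ.* 1ℚ                          ≡⟨ ℚ.*-identityʳ (ι μ) ⟩
    ι μ                                 ∎
    where open ≡-Reasoning
  opt<μ : opt (suc k) ℕ.< μ
  -- Integrality enters here: exceeding the optimum means exceeding it by at least one, which gives
  -- the extra `1/λ` below.
  opt<μ = ℕ.≰⇒> (unbalanced a ∘ maxLoadR≤opt⇒balanced (suc k) (A a))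
  1+1/λ≤ratio : 1ℚ ℚ.+ 1/λ ℚ.≤ ι μ ℚ.* 1/λ
  1+1/λ≤ratio = begin
    1ℚ ℚ.+ 1/λ                                ≡⟨ ℚ.+-comm 1ℚ 1/λ ⟩
    1/λ ℚ.+ 1ℚ                                ≡⟨ cong₂ ℚ._+_ (ℚ.*-identityˡ 1/λ) (ι*1/suc (pred-opt k)) ⟨
    1ℚ ℚ.* 1/λ ℚ.+ ι (opt (suc k)) ℚ.* 1/λ    ≡⟨ ℚ.*-distribʳ-+ 1/λ 1ℚ (ι (opt (suc k))) ⟨
    (1ℚ ℚ.+ ι (opt (suc k))) ℚ.* 1/λ          ≡⟨ cong (ℚ._* 1/λ) (trans (ι-homo-+ 1 (opt (suc k))) (cong (ℚ._+ ι (opt (suc k))) ι-1)) ⟨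
    ι (suc (opt (suc k))) ℚ.* 1/λ             ≤⟨ ℚ.*-monoʳ-≤-nonNeg 1/λ {{nonNeg-1/λ}} (ι-mono-≤ opt<μ) ⟩
    ι μ ℚ.* 1/λ                               ∎
    where
    open ℚ.≤-Reasoning
    nonNeg-1/λ : ℚ.NonNegative 1/λ
    nonNeg-1/λ = ℚ.nonNegative (ℚ.<⇒≤ (1/suc-pos (pred-opt k)))

-- The constant one sixth and the final bounds

opt≤6*square : ∀ k m → k ℕ.≤ suc m → opt (suc k) ℕ.≤ 6 ℕ.* suc m ^ 2
opt≤6*square k m k≤M = begin
  suc k ℕ.* suc (suc k)                    ≤⟨ ℕ.*-mono-≤ (ℕ.s≤s k≤M) (ℕ.s≤s (ℕ.s≤s k≤M)) ⟩
  -- The added polynomial is the exact difference of the two sides; it vanishes at `m = 0`, so `6`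
  -- cannot be lowered here.
  (2 ℕ.+ m) ℕ.* (3 ℕ.+ m)                  ≤⟨ ℕ.m≤m+n _ _ ⟩
  (2 ℕ.+ m) ℕ.* (3 ℕ.+ m) ℕ.+ (5 ℕ.* (m ℕ.* m) ℕ.+ 7 ℕ.* m)  ≡⟨ expand m ⟩
  6 ℕ.* suc m ^ 2                          ∎
  where
  open ℕ.≤-Reasoning
  expand : ∀ m → (2 ℕ.+ m) ℕ.* (3 ℕ.+ m) ℕ.+ (5 ℕ.* (m ℕ.* m) ℕ.+ 7 ℕ.* m)
               ≡ 6 ℕ.* (suc m ℕ.* (suc m ℕ.* 1))
  expand = solve-∀

-- Written so that it is definitionally every term of `c / (M ^ 2)` for `c = fromℚ (1/suc 5)`.
gap : ∀ M .{{_ : NonZero M}} → ℚ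
gap M = 1/suc 5 ℚ.* (+ 1 ℚ./ (M ^ 2)) {{m^n≢0 M 2}}

gap-suc : ∀ m → gap (suc m) ≡ 1/suc (ℕ.pred (6 ℕ.* suc m ^ 2))
gap-suc m = trans (cong (1/suc 5 ℚ.*_) (sym (1/suc-def (ℕ.pred (suc m ^ 2)))))
                  (1/suc-* 5 (ℕ.pred (suc m ^ 2)))

gap-pos : ∀ M .{{_ : NonZero M}} → 0ℚ ℚ.< gap M
gap-pos (suc m) = subst (0ℚ ℚ.<_) (sym (gap-suc m)) (1/suc-pos _)

gap≤ : ∀ M .{{_ : NonZero M}} k → k ℕ.≤ M → gap M ℚ.≤ 1/suc (pred-opt k)
gap≤ (suc m) k k≤M = subst (ℚ._≤ 1/suc (pred-opt k)) (sym (gap-suc m))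
  (1/suc-antitone (ℕ.s≤s⁻¹ (opt≤6*square k m k≤M)))

ratio≥1+gap : ∀ M .{{_ : NonZero M}} (A : Algorithm 2 M) →
  ∃[ q ] Ratios A (fromℚ q) × 1ℚ ℚ.+ gap M ℚ.≤ q
ratio≥1+gap M A =
  let k , k≤M , unbalanced = unbalanced-index A
      q , ratio , q≥ = large-ratio A k unbalanced
  in q , ratio , ℚ.≤-trans (ℚ.+-monoʳ-≤ 1ℚ (gap≤ M k k≤M)) q≥

theorem1 : (∃[ c ] 0ℝ < c ×
    (∀ (M : ℕ) .{{_ : NonZero M}} (A : Algorithm 2 M) →
    1ℝ + (c / (M ^ 2)) {{m^n≢0 M 2}} ≤sup Ratios A))
    ×
    (∀ (M : ℕ) .{{_ : NonZero M}} (A : Algorithm 2 M) →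
    1ℝ <sup Ratios A)
theorem1 =
  (fromℚ (1/suc 5)
  , (1/suc 5 , 1/suc-pos 5 , 0 , λ _ _ → ℚ.≤-reflexive (ℚ.+-identityˡ _))
  -- One rational ratio dominates every term of `1ℝ + c / (M ^ 2)`, so the `ε` and `N` of the
  -- hypothesis on `r` can be reused.
  , λ M A r (ε , 0<ε , N , r+ε≤x) →
      let q , ratio , q≥ = ratio≥1+gap M A
      in fromℚ q , ratio , ε , 0<ε , N , λ n N≤n → ℚ.≤-trans (r+ε≤x n N≤n) q≥)
  , λ M A →
      let q , ratio , q≥ = ratio≥1+gap M A
      in fromℚ q , ratio , gap M , gap-pos M , 0 , λ _ _ → q≥
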